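{- For every $n\in\mathbb N$, in the field $\mathbb Q(x)$ we have $$\frac{U_n}{U_{n+1}}=\left[0;2x-1,1,\underbrace{2(x-1),1,2(x-1),1,\dots,2(x-1),1}_{n\text{ copies of the pair }2(x-1),1}\right].$$
   Context: $U_n=U_n(x)$ denotes the Chebyshev polynomial of the second kind: $U_0=1$, $U_1=2x$, $U_{n+1}=2xU_n-U_{n-1}$ for $n\ge1$. For elements $a_0,a_1,\dots,a_m$ the finite continued fraction is $[a_0;a_1,\dots,a_m]=a_0+\cfrac{1}{a_1+\cfrac{1}{\ddots+\cfrac{1}{a_m}}}$. -}

module Defs where

open import Algebra.Apartness.Bundles using (HeytingField)
import Algebra.Apartness.Properties.HeytingCommutativeRing as HeytingProperties
open import Algebra.Bundles using (CommutativeRing)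
open import Algebra.Definitions using (Invertible)
import Algebra.Properties.Ring as RingProperties
import Algebra.Solver.Ring.NaturalCoefficients.Default as SemiringSolver
open import Data.List.Base using (List; []; _∷_; map)
open import Data.Nat.Base using (ℕ; zero; suc)
open import Data.Product.Base using (Σ-syntax; _,_; proj₁; proj₂)
open import Data.Rational.Base as ℚ using (ℚ; 0ℚ; 1ℚ)
import Data.Rational.Properties as ℚ
open import Data.Sum.Base using (_⊎_; inj₁; inj₂; [_,_]′)
open import Data.Unit.Polymorphic.Base using (⊤)
open import Level using (_⊔_; 0ℓ)
open import Relation.Binary.Bundles using (DecSetoid)
open import Relation.Binary.Definitions using (Decidable)
import Relation.Binary.Properties.DecSetoid as DecSetoidProperties
open import Relation.Binary.PropositionalEquality as ≡
  using (_≡_; refl; cong; cong₂; module ≡-Reasoning)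
import Relation.Binary.Reasoning.Setoid as SetoidReasoning
open import Relation.Nullary.Decidable.Core using (Dec; yes; no; map′; _×-dec_)
open import Relation.Nullary.Negation.Core using (¬_; contradiction)

record IsDecIntegralDomain {c ℓ} (R : CommutativeRing c ℓ) : Set (c ⊔ ℓ) where
  open CommutativeRing R
  field
    _≟_      : Decidable _≈_
    1≉0      : ¬ 1# ≈ 0#
    integral : ∀ a b → a * b ≈ 0# → a ≈ 0# ⊎ b ≈ 0#

------------------------------------------------------------------------
-- The polynomial ring ℚ[x]

-- Coefficients are listed from degree 0 upwards and trailing zeros are
-- allowed, so the equality of ℚ[x] is _≈_, not _≡_.

module Polynomial where

  ℚ[x] : Set
  ℚ[x] = List ℚ

  coeff : ℚ[x] → ℕ → ℚ
  coeff []      _       = 0ℚ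
  coeff (a ∷ p) zero    = a
  coeff (a ∷ p) (suc i) = coeff p i

  infix  8 -_
  infixl 7 _*_ _·_
  infixl 6 _+_
  infix  4 _≈_ _≟_

  record _≈_ (p q : ℚ[x]) : Set where
    constructor coeffwise
    field at : ∀ i → coeff p i ≡ coeff q i
  open _≈_ public

  const : ℚ → ℚ[x]
  const a = a ∷ []

  0# 1# X : ℚ[x]
  0# = []
  1# = const 1ℚ
  X  = 0ℚ ∷ 1ℚ ∷ []

  _+_ : ℚ[x] → ℚ[x] → ℚ[x]
  []      + q       = q
  (a ∷ p) + []      = a ∷ p
  (a ∷ p) + (b ∷ q) = (a ℚ.+ b) ∷ (p + q)

  -_ : ℚ[x] → ℚ[x]
  - p = map ℚ.-_ p

  _·_ : ℚ → ℚ[x] → ℚ[x]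
  a · p = map (a ℚ.*_) p

  -- (a + x p) q = a q + x (p q)
  _*_ : ℚ[x] → ℚ[x] → ℚ[x]
  []      * q = []
  (a ∷ p) * q = a · q + (0ℚ ∷ p * q)

  coeff-+ : ∀ p q i → coeff (p + q) i ≡ coeff p i ℚ.+ coeff q i
  coeff-+ []      q       i       = ≡.sym (ℚ.+-identityˡ _)
  coeff-+ (a ∷ p) []      i       = ≡.sym (ℚ.+-identityʳ _)
  coeff-+ (a ∷ p) (b ∷ q) zero    = refl
  coeff-+ (a ∷ p) (b ∷ q) (suc i) = coeff-+ p q i

  coeff-neg : ∀ p i → coeff (- p) i ≡ ℚ.- coeff p i
  coeff-neg []      i       = refl
  coeff-neg (a ∷ p) zero    = refl
  coeff-neg (a ∷ p) (suc i) = coeff-neg p i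

  coeff-· : ∀ a p i → coeff (a · p) i ≡ a ℚ.* coeff p i
  coeff-· a []      i       = ≡.sym (ℚ.*-zeroʳ a)
  coeff-· a (b ∷ p) zero    = refl
  coeff-· a (b ∷ p) (suc i) = coeff-· a p i

  ≈-refl : ∀ {p} → p ≈ p
  ≈-refl = coeffwise λ _ → refl

  ≈-sym : ∀ {p q} → p ≈ q → q ≈ p
  ≈-sym p≈q = coeffwise λ i → ≡.sym (at p≈q i)

  ≈-trans : ∀ {p q r} → p ≈ q → q ≈ r → p ≈ r
  ≈-trans p≈q q≈r = coeffwise λ i → ≡.trans (at p≈q i) (at q≈r i)

  ∷-cong : ∀ {a b p q} → a ≡ b → p ≈ q → (a ∷ p) ≈ (b ∷ q)
  ∷-cong a≡b p≈q = coeffwise λ { zero → a≡b ; (suc i) → at p≈q i }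

  ∷-injectiveˡ : ∀ {a b p q} → (a ∷ p) ≈ (b ∷ q) → a ≡ b
  ∷-injectiveˡ e = at e zero

  ∷-injectiveʳ : ∀ {a b p q} → (a ∷ p) ≈ (b ∷ q) → p ≈ q
  ∷-injectiveʳ e = coeffwise λ i → at e (suc i)

  0∷0≈0 : (0ℚ ∷ 0#) ≈ 0#
  0∷0≈0 = coeffwise λ { zero → refl ; (suc i) → refl }

  +-cong : ∀ {p p′ q q′} → p ≈ p′ → q ≈ q′ → p + q ≈ p′ + q′
  +-cong {p} {p′} {q} {q′} e f = coeffwise λ i → begin
    coeff (p + q) i             ≡⟨ coeff-+ p q i ⟩
    coeff p i ℚ.+ coeff q i     ≡⟨ cong₂ ℚ._+_ (at e i) (at f i) ⟩
    coeff p′ i ℚ.+ coeff q′ i   ≡⟨ coeff-+ p′ q′ i ⟨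
    coeff (p′ + q′) i           ∎
    where open ≡-Reasoning

  +-comm : ∀ p q → p + q ≈ q + p
  +-comm p q = coeffwise λ i → begin
    coeff (p + q) i           ≡⟨ coeff-+ p q i ⟩
    coeff p i ℚ.+ coeff q i   ≡⟨ ℚ.+-comm (coeff p i) (coeff q i) ⟩
    coeff q i ℚ.+ coeff p i   ≡⟨ coeff-+ q p i ⟨
    coeff (q + p) i           ∎
    where open ≡-Reasoning

  +-assoc : ∀ p q r → (p + q) + r ≈ p + (q + r)
  +-assoc p q r = coeffwise λ i → begin
    coeff ((p + q) + r) i                     ≡⟨ coeff-+ (p + q) r i ⟩
    coeff (p + q) i ℚ.+ coeff r i             ≡⟨ cong (ℚ._+ _) (coeff-+ p q i) ⟩
    (coeff p i ℚ.+ coeff q i) ℚ.+ coeff r i   ≡⟨ ℚ.+-assoc (coeff p i) (coeff q i) (coeff r i) ⟩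
    coeff p i ℚ.+ (coeff q i ℚ.+ coeff r i)   ≡⟨ cong (coeff p i ℚ.+_) (coeff-+ q r i) ⟨
    coeff p i ℚ.+ coeff (q + r) i             ≡⟨ coeff-+ p (q + r) i ⟨
    coeff (p + (q + r)) i                     ∎
    where open ≡-Reasoning

  +-identityʳ : ∀ p → p + 0# ≈ p
  +-identityʳ []      = ≈-refl
  +-identityʳ (a ∷ p) = ≈-refl

  -‿cong : ∀ {p q} → p ≈ q → - p ≈ - q
  -‿cong {p} {q} e = coeffwise λ i → begin
    coeff (- p) i    ≡⟨ coeff-neg p i ⟩
    ℚ.- coeff p i    ≡⟨ cong ℚ.-_ (at e i) ⟩
    ℚ.- coeff q i    ≡⟨ coeff-neg q i ⟨
    coeff (- q) i    ∎
    where open ≡-Reasoning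

  -‿inverseˡ : ∀ p → - p + p ≈ 0#
  -‿inverseˡ p = coeffwise λ i → begin
    coeff (- p + p) i               ≡⟨ coeff-+ (- p) p i ⟩
    coeff (- p) i ℚ.+ coeff p i     ≡⟨ cong (ℚ._+ coeff p i) (coeff-neg p i) ⟩
    ℚ.- coeff p i ℚ.+ coeff p i     ≡⟨ ℚ.+-inverseˡ (coeff p i) ⟩
    0ℚ                              ∎
    where open ≡-Reasoning

  -‿inverseʳ : ∀ p → p + - p ≈ 0#
  -‿inverseʳ p = ≈-trans (+-comm p (- p)) (-‿inverseˡ p)

  +-exchange : ∀ p q r s → (p + q) + (r + s) ≈ (p + r) + (q + s)
  +-exchange p q r s =
    ≈-trans (+-assoc p q (r + s))
    (≈-trans (+-cong {p} ≈-refl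
      (≈-trans (≈-sym (+-assoc q r s))
      (≈-trans (+-cong {q + r} {r + q} {s} (+-comm q r) ≈-refl)
               (+-assoc r q s))))
    (≈-sym (+-assoc p r (q + s))))

  ·-cong : ∀ a {p q} → p ≈ q → a · p ≈ a · q
  ·-cong a {p} {q} e = coeffwise λ i → begin
    coeff (a · p) i   ≡⟨ coeff-· a p i ⟩
    a ℚ.* coeff p i   ≡⟨ cong (a ℚ.*_) (at e i) ⟩
    a ℚ.* coeff q i   ≡⟨ coeff-· a q i ⟨
    coeff (a · q) i   ∎
    where open ≡-Reasoning

  ·-zeroˡ : ∀ p → 0ℚ · p ≈ 0#
  ·-zeroˡ p = coeffwise λ i → ≡.trans (coeff-· 0ℚ p i) (ℚ.*-zeroˡ (coeff p i))

  ·-identityˡ : ∀ p → 1ℚ · p ≈ p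
  ·-identityˡ p = coeffwise λ i → ≡.trans (coeff-· 1ℚ p i) (ℚ.*-identityˡ (coeff p i))

  ·-assoc : ∀ a b p → (a ℚ.* b) · p ≈ a · (b · p)
  ·-assoc a b p = coeffwise λ i → begin
    coeff ((a ℚ.* b) · p) i     ≡⟨ coeff-· (a ℚ.* b) p i ⟩
    (a ℚ.* b) ℚ.* coeff p i     ≡⟨ ℚ.*-assoc a b (coeff p i) ⟩
    a ℚ.* (b ℚ.* coeff p i)     ≡⟨ cong (a ℚ.*_) (coeff-· b p i) ⟨
    a ℚ.* coeff (b · p) i       ≡⟨ coeff-· a (b · p) i ⟨
    coeff (a · (b · p)) i       ∎
    where open ≡-Reasoning

  ·-distribˡ : ∀ a p q → a · (p + q) ≈ a · p + a · q
  ·-distribˡ a p q = coeffwise λ i → begin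
    coeff (a · (p + q)) i                     ≡⟨ coeff-· a (p + q) i ⟩
    a ℚ.* coeff (p + q) i                     ≡⟨ cong (a ℚ.*_) (coeff-+ p q i) ⟩
    a ℚ.* (coeff p i ℚ.+ coeff q i)           ≡⟨ ℚ.*-distribˡ-+ a (coeff p i) (coeff q i) ⟩
    a ℚ.* coeff p i ℚ.+ a ℚ.* coeff q i       ≡⟨ cong₂ ℚ._+_ (coeff-· a p i) (coeff-· a q i) ⟨
    coeff (a · p) i ℚ.+ coeff (a · q) i       ≡⟨ coeff-+ (a · p) (a · q) i ⟨
    coeff (a · p + a · q) i                   ∎
    where open ≡-Reasoning

  *-congˡ : ∀ p {q q′} → q ≈ q′ → p * q ≈ p * q′
  *-congˡ []      e = ≈-refl
  *-congˡ (a ∷ p) e = +-cong (·-cong a e) (∷-cong refl (*-congˡ p e))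

  *-zeroʳ : ∀ p → p * 0# ≈ 0#
  *-zeroʳ []      = ≈-refl
  *-zeroʳ (a ∷ p) = ≈-trans (∷-cong refl (*-zeroʳ p)) 0∷0≈0

  *-∷ : ∀ q a p → q * (a ∷ p) ≈ a · q + (0ℚ ∷ q * p)
  *-∷ []      a p = ≈-sym 0∷0≈0
  *-∷ (b ∷ q) a p = ∷-cong
    (cong (ℚ._+ 0ℚ) (ℚ.*-comm b a))
    (≈-trans (+-cong {b · p} ≈-refl (*-∷ q a p))
    (≈-trans (≈-sym (+-assoc (b · p) (a · q) (0ℚ ∷ q * p)))
    (≈-trans (+-cong {b · p + a · q} (+-comm (b · p) (a · q)) ≈-refl)
             (+-assoc (a · q) (b · p) (0ℚ ∷ q * p)))))

  *-comm : ∀ p q → p * q ≈ q * p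
  *-comm []      q = ≈-sym (*-zeroʳ q)
  *-comm (a ∷ p) q =
    ≈-trans (+-cong {a · q} ≈-refl (∷-cong refl (*-comm p q))) (≈-sym (*-∷ q a p))

  *-congʳ : ∀ q {p p′} → p ≈ p′ → p * q ≈ p′ * q
  *-congʳ q {p} {p′} e = ≈-trans (*-comm p q) (≈-trans (*-congˡ q e) (*-comm q p′))

  *-cong : ∀ {p p′ q q′} → p ≈ p′ → q ≈ q′ → p * q ≈ p′ * q′
  *-cong {p} {p′} {q} {q′} e f = ≈-trans (*-congʳ q e) (*-congˡ p′ f)

  *-distribˡ-+ : ∀ p q r → p * (q + r) ≈ p * q + p * r
  *-distribˡ-+ []      q r = ≈-refl
  *-distribˡ-+ (a ∷ p) q r =
    ≈-trans (+-cong (·-distribˡ a q r) (∷-cong refl (*-distribˡ-+ p q r)))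
            (+-exchange (a · q) (a · r) (0ℚ ∷ p * q) (0ℚ ∷ p * r))

  *-distribʳ-+ : ∀ p q r → (q + r) * p ≈ q * p + r * p
  *-distribʳ-+ p q r =
    ≈-trans (*-comm (q + r) p)
    (≈-trans (*-distribˡ-+ p q r) (+-cong (*-comm p q) (*-comm p r)))

  ·-*-assoc : ∀ a p q → (a · p) * q ≈ a · (p * q)
  ·-*-assoc a []      q = ≈-refl
  ·-*-assoc a (b ∷ p) q =
    ≈-trans (+-cong (·-assoc a b q) (∷-cong (≡.sym (ℚ.*-zeroʳ a)) (·-*-assoc a p q)))
            (≈-sym (·-distribˡ a (b · q) (0ℚ ∷ p * q)))

  0∷-* : ∀ p q → (0ℚ ∷ p) * q ≈ (0ℚ ∷ p * q)
  0∷-* p q = +-cong {0ℚ · q} (·-zeroˡ q) ≈-refl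

  *-0∷ : ∀ p q → p * (0ℚ ∷ q) ≈ (0ℚ ∷ p * q)
  *-0∷ p q = ≈-trans (*-comm p (0ℚ ∷ q)) (≈-trans (0∷-* q p) (∷-cong refl (*-comm q p)))

  *-assoc : ∀ p q r → (p * q) * r ≈ p * (q * r)
  *-assoc []      q r = ≈-refl
  *-assoc (a ∷ p) q r =
    ≈-trans (*-distribʳ-+ r (a · q) (0ℚ ∷ p * q))
            (+-cong (·-*-assoc a q r)
                    (≈-trans (0∷-* (p * q) r) (∷-cong refl (*-assoc p q r))))

  *-identityˡ : ∀ p → 1# * p ≈ p
  *-identityˡ p =
    ≈-trans (+-cong (·-identityˡ p) 0∷0≈0) (+-identityʳ p)

  commutativeRing : CommutativeRing 0ℓ 0ℓ
  commutativeRing = record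
    { Carrier = ℚ[x]
    ; _≈_     = _≈_
    ; _+_     = _+_
    ; _*_     = _*_
    ; -_      = -_
    ; 0#      = 0#
    ; 1#      = 1#
    ; isCommutativeRing = record
      { isRing = record
        { +-isAbelianGroup = record
          { isGroup = record
            { isMonoid = record
              { isSemigroup = record
                { isMagma = record
                  { isEquivalence = record { refl = ≈-refl ; sym = ≈-sym ; trans = ≈-trans }
                  ; ∙-cong        = +-cong
                  }
                ; assoc = +-assoc
                }
              ; identity = (λ _ → ≈-refl) , +-identityʳ
              }
            ; inverse = -‿inverseˡ , -‿inverseʳ
            ; ⁻¹-cong = -‿cong
            }
          ; comm = +-comm
          }
        ; *-cong     = *-cong
        ; *-assoc    = *-assoc
        ; *-identity = *-identityˡ , λ p → ≈-trans (*-comm p 1#) (*-identityˡ p)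
        ; distrib    = *-distribˡ-+ , *-distribʳ-+
        }
      ; *-comm = *-comm
      }
    }

  zero? : ∀ p → Dec (p ≈ 0#)
  zero? []      = yes ≈-refl
  zero? (a ∷ p) = map′
    (λ (a≡0 , p≈0) → ≈-trans (∷-cong a≡0 p≈0) 0∷0≈0)
    (λ e → at e zero , coeffwise λ i → at e (suc i))
    (a ℚ.≟ 0ℚ ×-dec zero? p)

  _≟_ : Decidable _≈_
  []      ≟ q       = map′ ≈-sym ≈-sym (zero? q)
  (a ∷ p) ≟ []      = zero? (a ∷ p)
  (a ∷ p) ≟ (b ∷ q) = map′
    (λ (a≡b , p≈q) → ∷-cong a≡b p≈q)
    (λ e → ∷-injectiveˡ e , ∷-injectiveʳ e)
    (a ℚ.≟ b ×-dec p ≟ q)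

  1≉0 : ¬ 1# ≈ 0#
  1≉0 e with () ← at e zero

  tail≈0 : ∀ {a p} → (a ∷ p) ≈ 0# → p ≈ 0#
  tail≈0 e = coeffwise λ i → at e (suc i)

  ℚ-integral : ∀ a b → a ℚ.* b ≡ 0ℚ → ¬ a ≡ 0ℚ → b ≡ 0ℚ
  ℚ-integral a b ab≡0 a≢0 = begin
    b                      ≡⟨ ℚ.*-identityˡ b ⟨
    1ℚ ℚ.* b               ≡⟨ cong (ℚ._* b) (ℚ.*-inverseˡ a) ⟨
    (ℚ.1/ a) ℚ.* a ℚ.* b   ≡⟨ ℚ.*-assoc (ℚ.1/ a) a b ⟩
    (ℚ.1/ a) ℚ.* (a ℚ.* b) ≡⟨ cong ((ℚ.1/ a) ℚ.*_) ab≡0 ⟩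
    (ℚ.1/ a) ℚ.* 0ℚ        ≡⟨ ℚ.*-zeroʳ (ℚ.1/ a) ⟩
    0ℚ                     ∎
    where
    open ≡-Reasoning
    instance
      a-nonZero : ℚ.NonZero a
      a-nonZero = ℚ.≢-nonZero a≢0

  ∷-integral : ∀ a p q → ¬ a ≡ 0ℚ → (a ∷ p) * q ≈ 0# → q ≈ 0#
  ∷-integral a p []      a≢0 e = ≈-refl
  ∷-integral a p (b ∷ q) a≢0 e = ≈-trans
    (∷-cong b≡0 (∷-integral a p q a≢0 (tail≈0 (≈-trans (≈-sym (*-0∷ (a ∷ p) q)) e′))))
    0∷0≈0
    where
    b≡0 : b ≡ 0ℚ
    b≡0 = ℚ-integral a b (≡.trans (≡.sym (ℚ.+-identityʳ (a ℚ.* b))) (at e zero)) a≢0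

    e′ : (a ∷ p) * (0ℚ ∷ q) ≈ 0#
    e′ = ≈-trans (*-congˡ (a ∷ p) (∷-cong (≡.sym b≡0) ≈-refl)) e

  integral : ∀ p q → p * q ≈ 0# → p ≈ 0# ⊎ q ≈ 0#
  integral []      q e = inj₁ ≈-refl
  integral (a ∷ p) q e with a ℚ.≟ 0ℚ
  ... | yes a≡0 = [ (λ p≈0 → inj₁ (≈-trans (∷-cong a≡0 p≈0) 0∷0≈0)) , inj₂ ]′
        (integral p q (tail≈0
          (≈-trans (≈-sym (≈-trans (*-congʳ q {a ∷ p} {0ℚ ∷ p} (∷-cong a≡0 ≈-refl)) (0∷-* p q))) e)))
  ... | no a≢0  = inj₂ (∷-integral a p q a≢0 e)

  isDecIntegralDomain : IsDecIntegralDomain commutativeRing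
  isDecIntegralDomain = record { _≟_ = _≟_ ; 1≉0 = 1≉0 ; integral = integral }

------------------------------------------------------------------------
-- The field of fractions of an integral domain with decidable equality

module Fraction {c ℓ} (R : CommutativeRing c ℓ) (domain : IsDecIntegralDomain R) where

  private module R = CommutativeRing R
  open IsDecIntegralDomain domain using (1≉0; integral) renaming (_≟_ to _≟ᴿ_)

  record Frac : Set (c ⊔ ℓ) where
    constructor mkFrac
    field
      num   : R.Carrier
      den   : R.Carrier
      den≉0 : ¬ (den R.≈ R.0#)
  open Frac public

  infix  8 -_
  infixl 7 _*_
  infixl 6 _+_
  infix  4 _≈_ _≉_ _≟_

  record _≈_ (f g : Frac) : Set ℓ where
    constructor cross
    field uncross : num f R.* den g R.≈ num g R.* den f
  open _≈_ public

  _≉_ : Frac → Frac → Set ℓ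
  f ≉ g = ¬ f ≈ g

  private
    *≉0 : ∀ {a b} → ¬ a R.≈ R.0# → ¬ b R.≈ R.0# → ¬ a R.* b R.≈ R.0#
    *≉0 a≉0 b≉0 ab≈0 = [ a≉0 , b≉0 ]′ (integral _ _ ab≈0)

    *-cancelˡ : ∀ a b d → ¬ a R.≈ R.0# → a R.* b R.≈ a R.* d → b R.≈ d
    *-cancelˡ a b d a≉0 ab≈ad
      with integral a (b R.- d)
             (R.trans (RingProperties.x[y-z]≈xy-xz R.ring a b d)
             (R.trans (R.+-congʳ ab≈ad) (R.-‿inverseʳ (a R.* d))))
    ... | inj₁ a≈0   = contradiction a≈0 a≉0
    ... | inj₂ b-d≈0 = RingProperties.x∙y⁻¹≈ε⇒x≈y R.ring b d b-d≈0

  ι : R.Carrier → Frac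
  ι a = mkFrac a R.1# 1≉0

  0# 1# : Frac
  0# = ι R.0#
  1# = ι R.1#

  _+_ _*_ : Frac → Frac → Frac
  mkFrac a b b≉0 + mkFrac d e e≉0 =
    mkFrac (a R.* e R.+ d R.* b) (b R.* e) (*≉0 b≉0 e≉0)
  mkFrac a b b≉0 * mkFrac d e e≉0 =
    mkFrac (a R.* d) (b R.* e) (*≉0 b≉0 e≉0)

  -_ : Frac → Frac
  - mkFrac a b b≉0 = mkFrac (R.- a) b b≉0

  _≟_ : Decidable _≈_
  f ≟ g = map′ cross uncross ((num f R.* den g) ≟ᴿ (num g R.* den f))

  open SemiringSolver R.commutativeSemiring using (solve; _:+_; _:*_; _:=_; con)

  ≈-refl : ∀ {f} → f ≈ f
  ≈-refl = cross R.refl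

  ≈-sym : ∀ {f g} → f ≈ g → g ≈ f
  ≈-sym (cross e) = cross (R.sym e)

  ≈-trans : ∀ {f g h} → f ≈ g → g ≈ h → f ≈ h
  ≈-trans {mkFrac a b _} {mkFrac a′ b′ b′≉0} {mkFrac a″ b″ _} (cross e) (cross e′) =
    cross (*-cancelˡ b′ (a R.* b″) (a″ R.* b) b′≉0 (begin
      b′ R.* (a R.* b″)   ≈⟨ solve 3 (λ a b′ b″ → b′ :* (a :* b″) := (a :* b′) :* b″) R.refl a b′ b″ ⟩
      (a R.* b′) R.* b″   ≈⟨ R.*-congʳ e ⟩
      (a′ R.* b) R.* b″   ≈⟨ solve 3 (λ a′ b b″ → (a′ :* b) :* b″ := b :* (a′ :* b″)) R.refl a′ b b″ ⟩
      b R.* (a′ R.* b″)   ≈⟨ R.*-congˡ e′ ⟩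
      b R.* (a″ R.* b′)   ≈⟨ solve 3 (λ b a″ b′ → b :* (a″ :* b′) := b′ :* (a″ :* b)) R.refl b a″ b′ ⟩
      b′ R.* (a″ R.* b)   ∎))
    where open SetoidReasoning R.setoid

  +-cong : ∀ {f f′ g g′} → f ≈ f′ → g ≈ g′ → f + g ≈ f′ + g′
  +-cong {mkFrac a b _} {mkFrac a′ b′ _} {mkFrac d e _} {mkFrac d′ e′ _} (cross p) (cross q) =
    cross (begin
      (a R.* e R.+ d R.* b) R.* (b′ R.* e′)
        ≈⟨ regroup a b b′ d e e′ ⟩
      (a R.* b′) R.* (e R.* e′) R.+ (d R.* e′) R.* (b R.* b′)
        ≈⟨ R.+-cong (R.*-congʳ p) (R.*-congʳ q) ⟩
      (a′ R.* b) R.* (e R.* e′) R.+ (d′ R.* e) R.* (b R.* b′)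
        ≈⟨ R.+-cong (R.*-congˡ (R.*-comm e e′)) (R.*-congˡ (R.*-comm b b′)) ⟩
      (a′ R.* b) R.* (e′ R.* e) R.+ (d′ R.* e) R.* (b′ R.* b)
        ≈⟨ regroup a′ b′ b d′ e′ e ⟨
      (a′ R.* e′ R.+ d′ R.* b′) R.* (b R.* e)
        ∎)
    where
    open SetoidReasoning R.setoid
    regroup = solve 6 (λ a b b′ d e e′ →
      (a :* e :+ d :* b) :* (b′ :* e′) :=
      (a :* b′) :* (e :* e′) :+ (d :* e′) :* (b :* b′)) R.refl

  *-cong : ∀ {f f′ g g′} → f ≈ f′ → g ≈ g′ → f * g ≈ f′ * g′
  *-cong {mkFrac a b _} {mkFrac a′ b′ _} {mkFrac d e _} {mkFrac d′ e′ _} (cross p) (cross q) =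
    cross (begin
      (a R.* d) R.* (b′ R.* e′)    ≈⟨ regroup a d b′ e′ ⟩
      (a R.* b′) R.* (d R.* e′)    ≈⟨ R.*-cong p q ⟩
      (a′ R.* b) R.* (d′ R.* e)    ≈⟨ regroup a′ d′ b e ⟨
      (a′ R.* d′) R.* (b R.* e)    ∎)
    where
    open SetoidReasoning R.setoid
    regroup = solve 4 (λ a d b e → (a :* d) :* (b :* e) := (a :* b) :* (d :* e)) R.refl

  -‿cong : ∀ {f g} → f ≈ g → - f ≈ - g
  -‿cong {mkFrac a b _} {mkFrac d e _} (cross p) = cross (begin
    (R.- a) R.* e    ≈⟨ RingProperties.-‿distribˡ-* R.ring a e ⟨
    R.- (a R.* e)    ≈⟨ R.-‿cong p ⟩
    R.- (d R.* b)    ≈⟨ RingProperties.-‿distribˡ-* R.ring d b ⟩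
    (R.- d) R.* b    ∎)
    where open SetoidReasoning R.setoid

  +-assoc : ∀ f g h → (f + g) + h ≈ f + (g + h)
  +-assoc (mkFrac a b _) (mkFrac d e _) (mkFrac g h _) = cross
    (solve 6 (λ a b d e g h →
      ((a :* e :+ d :* b) :* h :+ g :* (b :* e)) :* (b :* (e :* h)) :=
      (a :* (e :* h) :+ (d :* h :+ g :* e) :* b) :* ((b :* e) :* h)) R.refl a b d e g h)

  +-comm : ∀ f g → f + g ≈ g + f
  +-comm (mkFrac a b _) (mkFrac d e _) = cross
    (solve 4 (λ a b d e →
      (a :* e :+ d :* b) :* (e :* b) := (d :* b :+ a :* e) :* (b :* e)) R.refl a b d e)

  +-identityˡ : ∀ f → 0# + f ≈ f
  +-identityˡ (mkFrac a b _) = cross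
    (solve 2 (λ a b →
      (con 0 :* b :+ a :* con 1) :* b := a :* (con 1 :* b)) R.refl a b)

  -‿inverseˡ : ∀ f → - f + f ≈ 0#
  -‿inverseˡ (mkFrac a b _) = cross (begin
    ((R.- a) R.* b R.+ a R.* b) R.* R.1#   ≈⟨ R.*-identityʳ _ ⟩
    (R.- a) R.* b R.+ a R.* b              ≈⟨ R.distribʳ b (R.- a) a ⟨
    (R.- a R.+ a) R.* b                    ≈⟨ R.*-congʳ (R.-‿inverseˡ a) ⟩
    R.0# R.* b                             ≈⟨ R.zeroˡ b ⟩
    R.0#                                   ≈⟨ R.zeroˡ (b R.* b) ⟨
    R.0# R.* (b R.* b)                     ∎)
    where open SetoidReasoning R.setoid

  *-assoc : ∀ f g h → (f * g) * h ≈ f * (g * h)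
  *-assoc (mkFrac a b _) (mkFrac d e _) (mkFrac g h _) = cross
    (solve 6 (λ a b d e g h →
      ((a :* d) :* g) :* (b :* (e :* h)) :=
      (a :* (d :* g)) :* ((b :* e) :* h)) R.refl a b d e g h)

  *-comm : ∀ f g → f * g ≈ g * f
  *-comm (mkFrac a b _) (mkFrac d e _) = cross
    (solve 4 (λ a b d e → (a :* d) :* (e :* b) := (d :* a) :* (b :* e)) R.refl a b d e)

  *-identityˡ : ∀ f → 1# * f ≈ f
  *-identityˡ (mkFrac a b _) = cross
    (solve 2 (λ a b → (con 1 :* a) :* b := a :* (con 1 :* b)) R.refl a b)

  *-distribˡ-+ : ∀ f g h → f * (g + h) ≈ f * g + f * h
  *-distribˡ-+ (mkFrac a b _) (mkFrac d e _) (mkFrac g h _) = cross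
    (solve 6 (λ a b d e g h →
      (a :* (d :* h :+ g :* e)) :* ((b :* e) :* (b :* h)) :=
      ((a :* d) :* (b :* h) :+ (a :* g) :* (b :* e)) :* (b :* (e :* h))) R.refl a b d e g h)

  *-distribʳ-+ : ∀ f g h → (g + h) * f ≈ g * f + h * f
  *-distribʳ-+ f g h =
    ≈-trans (*-comm (g + h) f)
    (≈-trans (*-distribˡ-+ f g h) (+-cong (*-comm f g) (*-comm f h)))

  commutativeRing : CommutativeRing (c ⊔ ℓ) ℓ
  commutativeRing = record
    { Carrier = Frac
    ; _≈_     = _≈_
    ; _+_     = _+_
    ; _*_     = _*_
    ; -_      = -_
    ; 0#      = 0#
    ; 1#      = 1#
    ; isCommutativeRing = record
      { isRing = record
        { +-isAbelianGroup = record
          { isGroup = record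
            { isMonoid = record
              { isSemigroup = record
                { isMagma = record
                  { isEquivalence = record { refl = ≈-refl ; sym = ≈-sym ; trans = ≈-trans }
                  ; ∙-cong        = +-cong
                  }
                ; assoc = +-assoc
                }
              ; identity = +-identityˡ , λ f → ≈-trans (+-comm f 0#) (+-identityˡ f)
              }
            ; inverse = -‿inverseˡ , λ f → ≈-trans (+-comm f (- f)) (-‿inverseˡ f)
            ; ⁻¹-cong = -‿cong
            }
          ; comm = +-comm
          }
        ; *-cong     = *-cong
        ; *-assoc    = *-assoc
        ; *-identity = *-identityˡ , λ f → ≈-trans (*-comm f 1#) (*-identityˡ f)
        ; distrib    = *-distribˡ-+ , *-distribʳ-+
        }
      ; *-comm = *-comm
      }
    }

  private
    module K = CommutativeRing commutativeRing

    decSetoid : DecSetoid (c ⊔ ℓ) ℓ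
    decSetoid = record
      { isDecEquivalence = record { isEquivalence = K.isEquivalence ; _≟_ = _≟_ } }

    num≉0 : ∀ {f} → f ≉ 0# → ¬ num f R.≈ R.0#
    num≉0 {f} f≉0 e = f≉0 (cross
      (R.trans (R.*-identityʳ (num f)) (R.trans e (R.sym (R.zeroˡ (den f))))))

    1≉0ᶠ : 1# ≉ 0#
    1≉0ᶠ (cross e) =
      1≉0 (R.trans (R.sym (R.*-identityʳ R.1#)) (R.trans e (R.zeroˡ R.1#)))

  recip : ∀ f → f ≉ 0# → Frac
  recip f f≉0 = mkFrac (den f) (num f) (num≉0 f≉0)

  recip-inverseˡ : ∀ f (f≉0 : f ≉ 0#) → recip f f≉0 * f ≈ 1#
  recip-inverseˡ (mkFrac a b _) _ = cross
    (solve 2 (λ a b → (b :* a) :* con 1 := con 1 :* (a :* b)) R.refl a b)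

  private
    invertible : ∀ f → f ≉ 0# → Invertible _≈_ 1# _*_ f
    invertible f f≉0 =
      recip f f≉0 ,
      recip-inverseˡ f f≉0 ,
      ≈-trans (*-comm f (recip f f≉0)) (recip-inverseˡ f f≉0)

  heytingField : HeytingField (c ⊔ ℓ) ℓ ℓ
  heytingField = record
    { Carrier = Frac
    ; _≈_     = _≈_
    ; _#_     = _≉_
    ; _+_     = _+_
    ; _*_     = _*_
    ; -_      = -_
    ; 0#      = 0#
    ; 1#      = 1#
    ; isHeytingField = record
      { isHeytingCommutativeRing = record
        { isCommutativeRing   = K.isCommutativeRing
        ; isApartnessRelation = DecSetoidProperties.≉-isApartnessRelation decSetoid
        ; #⇒invertible        = λ {f} {g} f≉g → invertible (f K.- g)
            (λ e → f≉g (RingProperties.x∙y⁻¹≈ε⇒x≈y K.ring f g e))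
        ; invertible⇒#        = λ {f} {g} (h , h[f-g]≈1 , _) f≈g →
            1≉0ᶠ (≈-trans (≈-sym h[f-g]≈1)
                 (≈-trans (*-cong {h} ≈-refl (RingProperties.x≈y⇒x∙y⁻¹≈ε K.ring f≈g))
                          (K.zeroʳ h)))
        }
      ; tight = DecSetoidProperties.≉-tight decSetoid
      }
    }

------------------------------------------------------------------------
-- Finite continued fractions over a field

module ContinuedFraction {c ℓ₁ ℓ₂} (F : HeytingField c ℓ₁ ℓ₂) where

  open HeytingField F

  infixl 7 _/_⟨_⟩
  infix  8 _⁻¹⟨_⟩

  -- #⇒invertible inverts the difference a - 0#.
  _⁻¹⟨_⟩ : ∀ a → a # 0# → Carrier
  a ⁻¹⟨ a#0 ⟩ = proj₁ (#⇒invertible a#0)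

  ⁻¹-inverseʳ : ∀ a (a#0 : a # 0#) → a * a ⁻¹⟨ a#0 ⟩ ≈ 1#
  ⁻¹-inverseʳ a a#0 = trans
    (*-congʳ (sym (HeytingProperties.x-0≈x heytingCommutativeRing a)))
    (proj₂ (proj₂ (#⇒invertible a#0)))

  _/_⟨_⟩ : ∀ a b → b # 0# → Carrier
  a / b ⟨ b#0 ⟩ = a * b ⁻¹⟨ b#0 ⟩

  -- [ a₀ ⨾ a₁ , … , aₘ ] is defined only if each tail [ aᵢ ⨾ aᵢ₊₁ , … , aₘ ]
  -- with 1 ≤ i ≤ m, being a denominator, is nonzero.
  mutual
    WellDefined : Carrier → List Carrier → Set ℓ₂
    WellDefined a []       = ⊤
    WellDefined a (b ∷ bs) = Σ[ d ∈ WellDefined b bs ] [ b ⨾ bs ]⟨ d ⟩ # 0#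

    [_⨾_]⟨_⟩ : ∀ a as → WellDefined a as → Carrier
    [ a ⨾ []     ]⟨ _       ⟩ = a
    [ a ⨾ b ∷ bs ]⟨ d , b#0 ⟩ = a + 1# / [ b ⨾ bs ]⟨ d ⟩ ⟨ b#0 ⟩

------------------------------------------------------------------------
-- Chebyshev polynomials of the second kind

module Chebyshev where
  open CommutativeRing Polynomial.commutativeRing
  open Polynomial using (ℚ[x]; const; X)

  2X : ℚ[x]
  2X = const (1ℚ ℚ.+ 1ℚ) * X

  U : ℕ → ℚ[x]
  U 0             = 1#
  U 1             = 2X
  U (suc (suc n)) = 2X * U (suc n) - U n

open Chebyshev public using (U)

------------------------------------------------------------------------
-- The field ℚ(x)

module RationalFunction = Fraction Polynomial.commutativeRing Polynomial.isDecIntegralDomain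

ℚ⟨x⟩ : HeytingField 0ℓ 0ℓ 0ℓ
ℚ⟨x⟩ = RationalFunction.heytingField

open HeytingField ℚ⟨x⟩ public using (Carrier; _≈_; _#_; _+_; _*_; -_; _-_; 0#; 1#)
open ContinuedFraction ℚ⟨x⟩ public
open RationalFunction public using (ι)

2# x : Carrier
2# = 1# + 1#
x  = ι Polynomial.X

-- Writing U₋₁ = 0, the recurrence U (n + 1) - U n = 2 (x - 1) U n + (U n - U (n - 1))
-- shows by induction on n that
--   [ 1 ; 2 (x - 1) , 1 , … , 2 (x - 1) , 1 ] = U n / (U n - U (n - 1))  (n pairs),
-- and the theorem follows from U (n + 1) = (2 x - 1) U n + (U n - U (n - 1)).
-- All the denominators are nonzero because at x = 1 the polynomials
-- U n and U (n + 1) - U n take the values n + 1 and 1.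

module Submission where

open import Defs using (module ContinuedFraction)
open import Algebra.Apartness.Bundles using (HeytingField; HeytingCommutativeRing)
import Algebra.Apartness.Properties.HeytingCommutativeRing as HeytingProperties
open import Algebra.Bundles using (CommutativeRing)
import Algebra.Properties.Ring as RingProperties
import Algebra.Solver.Ring.NaturalCoefficients.Default as SemiringSolver
open import Data.List.Base using (List; []; _∷_; concat; replicate; foldr)
open import Data.Nat.Base using (ℕ; zero; suc)
open import Data.Product.Base using (Σ-syntax; _,_)
open import Data.Rational.Base as ℚ using (ℚ; 0ℚ; 1ℚ)
import Data.Rational.Properties as ℚ
import Data.Rational.Solver as ℚ-Solver
open import Level using (_⊔_)
open import Relation.Binary.PropositionalEquality as ≡ using (_≡_; refl; cong; cong₂; module ≡-Reasoning)
import Relation.Binary.Reasoning.Setoid as SetoidReasoning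
open import Relation.Nullary.Negation.Core using (¬_)

-- Ring identities matching the partial quotients to the recurrence.

module _ {c ℓ} (R : CommutativeRing c ℓ) where
  open CommutativeRing R hiding (refl)
  open CommutativeRing R using () renaming (refl to ≈-refl)
  open RingProperties ring using (//-rightDividesˡ)
  open SemiringSolver commutativeSemiring using (solve; _:+_; _:*_; _:=_; con)
  open SetoidReasoning setoid

  -- For consecutive terms `v`, `u` of the recurrence the right side is the next term; this serves
  -- the partial quotient 2x - 1.
  [2x-1]u+[u-v]≈2xu-v : ∀ x u v →
    ((1# + 1#) * x - 1#) * u + (u - v) ≈ (1# + 1#) * x * u - v
  [2x-1]u+[u-v]≈2xu-v x u v = begin
    -- The solver is for semirings, so `2x - 1#` and `- v` are atoms and the cancellation of 1 is a
    -- separate step.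
    (2x - 1#) * u + (u - v)  ≈⟨ solve 3 (λ a u v → a :* u :+ (u :+ v) := (a :+ con 1) :* u :+ v)
                                  ≈-refl (2x - 1#) u (- v) ⟩
    (2x - 1# + 1#) * u - v   ≈⟨ +-congʳ (*-congʳ (//-rightDividesˡ 1# 2x)) ⟩
    2x * u - v               ∎
    where 2x = (1# + 1#) * x

  2[x-1]u+[u-v]≈2xu-v-u : ∀ x u v →
    (1# + 1#) * (x - 1#) * u + (u - v) ≈ (1# + 1#) * x * u - v - u
  2[x-1]u+[u-v]≈2xu-v-u x u v = begin
    (1# + 1#) * y * u + (u - v)
      -- Adding `u - u` supplies the atom `- u` of the target and the second `u` that completes 2 (y
      -- + 1) u.
      ≈⟨ +-identityʳ _ ⟨
    (1# + 1#) * y * u + (u - v) + 0#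
      ≈⟨ +-congˡ (-‿inverseʳ u) ⟨
    (1# + 1#) * y * u + (u - v) + (u - u)
      ≈⟨ solve 4 (λ y u u′ v′ →
           con 2 :* y :* u :+ (u :+ v′) :+ (u :+ u′) :=
           con 2 :* (y :+ con 1) :* u :+ v′ :+ u′) ≈-refl y u (- u) (- v) ⟩
    (1# + 1#) * (y + 1#) * u - v - u
      ≈⟨ +-congʳ (+-congʳ (*-congʳ (*-congˡ (//-rightDividesˡ 1# x)))) ⟩
    (1# + 1#) * x * u - v - u
      ∎
    where y = x - 1#

-- Continued fractions for ratios of a second-order recurrence.

module _ {c ℓ₁ ℓ₂} (F : HeytingField c ℓ₁ ℓ₂) where
  open HeytingField F hiding (refl)
  open HeytingField F using () renaming (refl to ≈-refl)
  open ContinuedFraction F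
  open HeytingProperties heytingCommutativeRing using (x-0≈x; invertibleʳ⇒#; #-congʳ)
  private
    R = HeytingCommutativeRing.commutativeRing heytingCommutativeRing
  open CommutativeRing R using (ring; commutativeSemiring)
  open RingProperties ring using (//-rightDividesˡ)
  open SemiringSolver commutativeSemiring using (solve; _:+_; _:*_; _:=_; con)
  open SetoidReasoning setoid

  -- The value is p / q, multiplied out so that q # 0# is not part of the data.
  HasValue : Carrier → List Carrier → Carrier → Carrier → Set (ℓ₁ ⊔ ℓ₂)
  HasValue a as p q = Σ[ d ∈ WellDefined a as ] [ a ⨾ as ]⟨ d ⟩ * q ≈ p

  HasValue-congˡ : ∀ {a as p p′ q} → p ≈ p′ → HasValue a as p q → HasValue a as p′ q
  HasValue-congˡ p≈p′ (d , tq≈p) = d , trans tq≈p p≈p′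

  -- The inverse of `x` is `y` times the inverse of `x * y`.
  x*y#0⇒x#0 : ∀ {x y} → x * y # 0# → x # 0#
  x*y#0⇒x#0 {x} {y} xy#0 = invertibleʳ⇒# (y * z , (begin
    (x - 0#) * (y * z)  ≈⟨ *-congʳ (x-0≈x x) ⟩
    x * (y * z)         ≈⟨ *-assoc x y z ⟨
    x * y * z           ≈⟨ ⁻¹-inverseʳ (x * y) xy#0 ⟩
    1#                  ∎))
    where z = (x * y) ⁻¹⟨ xy#0 ⟩

  -- If t = p / q, then a + 1 / t = (a p + q) / p. The tail t is nonzero because t q ≈ p, so a
  -- nonzero numerator `p` is all that a new layer asks for.
  HasValue-∷ : ∀ {a b bs p q} → p # 0# →
               HasValue b bs p q → HasValue a (b ∷ bs) (a * p + q) p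
  HasValue-∷ {a} {b} {bs} {p} {q} p#0 (d , tq≈p) = (d , t#0) , (begin
    (a + 1# * t⁻¹) * p        ≈⟨ *-congˡ tq≈p ⟨
    (a + 1# * t⁻¹) * (t * q)  ≈⟨ solve 4 (λ a t t′ q → (a :+ con 1 :* t′) :* (t :* q) :=
                                   a :* (t :* q) :+ (t :* t′) :* q) ≈-refl a t t⁻¹ q ⟩
    a * (t * q) + t * t⁻¹ * q ≈⟨ +-cong (*-congˡ tq≈p) (*-congʳ (⁻¹-inverseʳ t t#0)) ⟩
    a * p + 1# * q            ≈⟨ +-congˡ (*-identityˡ q) ⟩
    a * p + q                 ∎)
    where
    t = [ b ⨾ bs ]⟨ d ⟩
    t#0 = x*y#0⇒x#0 (#-congʳ (sym tq≈p) p#0)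
    t⁻¹ = t ⁻¹⟨ t#0 ⟩

  HasValue⇒≈ : ∀ {a as p q} (q#0 : q # 0#) → HasValue a as p q →
               Σ[ d ∈ WellDefined a as ] p / q ⟨ q#0 ⟩ ≈ [ a ⨾ as ]⟨ d ⟩
  HasValue⇒≈ {a} {as} {p} {q} q#0 (d , tq≈p) = d , (begin
    p * q⁻¹        ≈⟨ *-congʳ tq≈p ⟨
    t * q * q⁻¹    ≈⟨ *-assoc t q q⁻¹ ⟩
    t * (q * q⁻¹)  ≈⟨ *-congˡ (⁻¹-inverseʳ q q#0) ⟩
    t * 1#         ≈⟨ *-identityʳ t ⟩
    t              ∎)
    where
    t = [ a ⨾ as ]⟨ d ⟩
    q⁻¹ = q ⁻¹⟨ q#0 ⟩

  -- The sequence w is shifted by one: w (suc n) stands for U n, and w 0 for U₋₁ = 0.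
  module _ (x : Carrier) (w : ℕ → Carrier)
    (w₀≈0 : w 0 ≈ 0#)
    (w-rec : ∀ n → w (suc (suc n)) ≈ (1# + 1#) * x * w (suc n) - w n)
    (w#0 : ∀ n → w (suc n) # 0#) (Δw#0 : ∀ n → w (suc n) - w n # 0#)
    where

    private
      pairs : ℕ → List Carrier
      pairs n = concat (replicate n ((1# + 1#) * (x - 1#) ∷ 1# ∷ []))

    pairs-value : ∀ n → HasValue 1# (pairs n) (w (suc n)) (w (suc n) - w n)
    pairs-value zero = _ , (begin
      1# * (w 1 - w 0)  ≈⟨ *-identityˡ _ ⟩
      w 1 - w 0         ≈⟨ +-congˡ (-‿cong w₀≈0) ⟩
      w 1 - 0#          ≈⟨ x-0≈x (w 1) ⟩
      w 1               ∎)
    -- Prepending 2 (x - 1) turns u / (u - w n) into (w₂ - u) / u by the recurrence; prepending 1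
    -- then gives w₂ / (w₂ - u).
    pairs-value (suc n) = HasValue-congˡ
      (trans (+-congʳ (*-identityˡ _)) (//-rightDividesˡ u w₂))
      (HasValue-∷ (Δw#0 (suc n))
        (HasValue-congˡ eq (HasValue-∷ (w#0 n) (pairs-value n))))
      where
      u = w (suc n)
      w₂ = w (suc (suc n))

      eq : (1# + 1#) * (x - 1#) * u + (u - w n) ≈ w₂ - u
      eq = trans (2[x-1]u+[u-v]≈2xu-v-u R x u (w n)) (+-congʳ (sym (w-rec n)))

    ratio : ∀ n →
      Σ[ d ∈ WellDefined 0# ((1# + 1#) * x - 1# ∷ 1# ∷ pairs n) ]
        w (suc n) / w (suc (suc n)) ⟨ w#0 (suc n) ⟩ ≈
        [ 0# ⨾ (1# + 1#) * x - 1# ∷ 1# ∷ pairs n ]⟨ d ⟩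
    -- Prepending 2x - 1 to u / (u - w n) gives w (n + 2) / u, which the leading 0 inverts.
    ratio n = HasValue⇒≈ (w#0 (suc n)) (HasValue-congˡ
      (trans (+-congʳ (zeroˡ _)) (+-identityˡ _))
      (HasValue-∷ (w#0 (suc n))
        (HasValue-congˡ eq (HasValue-∷ (w#0 n) (pairs-value n)))))
      where
      u = w (suc n)

      eq : ((1# + 1#) * x - 1#) * u + (u - w n) ≈ w (suc (suc n))
      eq = trans ([2x-1]u+[u-v]≈2xu-v R x u (w n)) (sym (w-rec n))

open import Defs

-- Values of the Chebyshev polynomials at x = 1.

module ℚ[x] where
  open CommutativeRing Polynomial.commutativeRing public
  open RingProperties ring public using (x≈y⇒x∙y⁻¹≈ε)

-- Every power of x is 1 at x = 1, so evaluation there is the sum of the coefficients.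
eval₁ : Polynomial.ℚ[x] → ℚ
eval₁ = foldr ℚ._+_ 0ℚ

-- A list equal to 0 need not be empty, since trailing zeros are allowed. Equality of two
-- polynomials is brought to this case through their difference.
eval₁-≈0 : ∀ {p} → p ℚ[x].≈ ℚ[x].0# → eval₁ p ≡ 0ℚ
eval₁-≈0 {[]}    e = refl
eval₁-≈0 {a ∷ p} e =
  cong₂ ℚ._+_ (Polynomial.at e zero) (eval₁-≈0 {p} (Polynomial.tail≈0 e))

eval₁-+ : ∀ p q → eval₁ (p ℚ[x].+ q) ≡ eval₁ p ℚ.+ eval₁ q
eval₁-+ []      q       = ≡.sym (ℚ.+-identityˡ _)
eval₁-+ (a ∷ p) []      = ≡.sym (ℚ.+-identityʳ _)
eval₁-+ (a ∷ p) (b ∷ q) = begin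
  a ℚ.+ b ℚ.+ eval₁ (p ℚ[x].+ q)           ≡⟨ cong (a ℚ.+ b ℚ.+_) (eval₁-+ p q) ⟩
  a ℚ.+ b ℚ.+ (eval₁ p ℚ.+ eval₁ q)        ≡⟨ solve 4 (λ a b c d →
                                                a :+ b :+ (c :+ d) := (a :+ c) :+ (b :+ d))
                                                refl a b (eval₁ p) (eval₁ q) ⟩
  (a ℚ.+ eval₁ p) ℚ.+ (b ℚ.+ eval₁ q)      ∎
  where
  open ≡-Reasoning
  open ℚ-Solver.+-*-Solver

eval₁-neg : ∀ p → eval₁ (ℚ[x].- p) ≡ ℚ.- eval₁ p
eval₁-neg []      = refl
eval₁-neg (a ∷ p) = ≡.trans (cong (ℚ.- a ℚ.+_) (eval₁-neg p)) (≡.sym (ℚ.neg-distrib-+ a (eval₁ p)))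

eval₁-- : ∀ p q → eval₁ (p ℚ[x].- q) ≡ eval₁ p ℚ.- eval₁ q
eval₁-- p q = ≡.trans (eval₁-+ p (ℚ[x].- q)) (cong (eval₁ p ℚ.+_) (eval₁-neg q))

eval₁-· : ∀ a p → eval₁ (a Polynomial.· p) ≡ a ℚ.* eval₁ p
eval₁-· a []      = ≡.sym (ℚ.*-zeroʳ a)
eval₁-· a (b ∷ p) =
  ≡.trans (cong (a ℚ.* b ℚ.+_) (eval₁-· a p)) (≡.sym (ℚ.*-distribˡ-+ a b (eval₁ p)))

eval₁-* : ∀ p q → eval₁ (p ℚ[x].* q) ≡ eval₁ p ℚ.* eval₁ q
eval₁-* []      q = ≡.sym (ℚ.*-zeroˡ (eval₁ q))
eval₁-* (a ∷ p) q = begin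
  eval₁ (a Polynomial.· q ℚ[x].+ (0ℚ ∷ p ℚ[x].* q))
    ≡⟨ eval₁-+ (a Polynomial.· q) (0ℚ ∷ p ℚ[x].* q) ⟩
  eval₁ (a Polynomial.· q) ℚ.+ (0ℚ ℚ.+ eval₁ (p ℚ[x].* q))
    ≡⟨ cong₂ ℚ._+_ (eval₁-· a q) (≡.trans (ℚ.+-identityˡ _) (eval₁-* p q)) ⟩
  a ℚ.* eval₁ q ℚ.+ eval₁ p ℚ.* eval₁ q
    ≡⟨ ℚ.*-distribʳ-+ (eval₁ q) a (eval₁ p) ⟨
  (a ℚ.+ eval₁ p) ℚ.* eval₁ q
    ∎
  where open ≡-Reasoning

-- At x = 1 the recurrence is u (n + 2) = 2 u (n + 1) - u n, so consecutive differences keep their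
-- initial value 1.
eval₁-U-suc : ∀ n → eval₁ (U (suc n)) ≡ 1ℚ ℚ.+ eval₁ (U n)
eval₁-U-suc zero    = refl
eval₁-U-suc (suc n) = begin
  eval₁ (Chebyshev.2X ℚ[x].* U (suc n) ℚ[x].- U n)
    ≡⟨ eval₁-- (Chebyshev.2X ℚ[x].* U (suc n)) (U n) ⟩
  eval₁ (Chebyshev.2X ℚ[x].* U (suc n)) ℚ.- u
    ≡⟨ cong (ℚ._- u) (eval₁-* Chebyshev.2X (U (suc n))) ⟩
  -- `eval₁ Chebyshev.2X` computes to `1ℚ ℚ.+ 1ℚ`.
  (1ℚ ℚ.+ 1ℚ) ℚ.* eval₁ (U (suc n)) ℚ.- u
    ≡⟨ cong (λ v → (1ℚ ℚ.+ 1ℚ) ℚ.* v ℚ.- u) (eval₁-U-suc n) ⟩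
  (1ℚ ℚ.+ 1ℚ) ℚ.* (1ℚ ℚ.+ u) ℚ.- u
    ≡⟨ solve 1 (λ u → con (1ℚ ℚ.+ 1ℚ) :* (con 1ℚ :+ u) :- u := con 1ℚ :+ (con 1ℚ :+ u)) refl u ⟩
  1ℚ ℚ.+ (1ℚ ℚ.+ u)
    ≡⟨ cong (1ℚ ℚ.+_) (eval₁-U-suc n) ⟨
  1ℚ ℚ.+ eval₁ (U (suc n))
    ∎
  where
  open ≡-Reasoning
  open ℚ-Solver.+-*-Solver
  u = eval₁ (U n)

eval₁-U-positive : ∀ n → ℚ.Positive (eval₁ (U n))
eval₁-U-positive zero    = _
eval₁-U-positive (suc n) = ≡.subst ℚ.Positive (≡.sym (eval₁-U-suc n))
  (ℚ.pos+pos⇒pos 1ℚ (eval₁ (U n)) {{eval₁-U-positive n}})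

U≉0 : ∀ n → ¬ U n ℚ[x].≈ ℚ[x].0#
U≉0 n e with () ← ≡.subst ℚ.Positive (eval₁-≈0 e) (eval₁-U-positive n)

U-suc≉U : ∀ n → ¬ U (suc n) ℚ[x].≈ U n
U-suc≉U n e = ℚ.1≢0 (begin
  1ℚ                                     ≡⟨ solve 1 (λ u → con 1ℚ := con 1ℚ :+ u :- u) refl u ⟩
  1ℚ ℚ.+ u ℚ.- u                         ≡⟨ cong (ℚ._- u) (eval₁-U-suc n) ⟨
  eval₁ (U (suc n)) ℚ.- u                ≡⟨ eval₁-- (U (suc n)) (U n) ⟨
  eval₁ (U (suc n) ℚ[x].- U n)           ≡⟨ eval₁-≈0 (ℚ[x].x≈y⇒x∙y⁻¹≈ε e) ⟩
  0ℚ                                     ∎)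
  where
  open ≡-Reasoning
  open ℚ-Solver.+-*-Solver
  u = eval₁ (U n)

-- Transfer of the recurrence and of the nonvanishing to ℚ(x).

module ℚ⟨x⟩ where
  open HeytingField ℚ⟨x⟩ public
  open CommutativeRing (HeytingCommutativeRing.commutativeRing heytingCommutativeRing)
    public using (ring)
  open RingProperties ring public using (x∙y⁻¹≈ε⇒x≈y)

ι-injective : ∀ {p q} → ι p ≈ ι q → p ℚ[x].≈ q
ι-injective (RationalFunction.cross e) =
  ℚ[x].trans (ℚ[x].sym (ℚ[x].*-identityʳ _)) (ℚ[x].trans e (ℚ[x].*-identityʳ _))

ι-* : ∀ p q → ι (p ℚ[x].* q) ≈ ι p * ι q
ι-* p q = RationalFunction.cross (ℚ[x].*-congˡ {p ℚ[x].* q} (ℚ[x].*-identityˡ ℚ[x].1#))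

ι-+ : ∀ p q → ι (p ℚ[x].+ q) ≈ ι p + ι q
ι-+ p q = RationalFunction.cross (ℚ[x].*-cong
  (ℚ[x].sym (ℚ[x].+-cong (ℚ[x].*-identityʳ p) (ℚ[x].*-identityʳ q)))
  (ℚ[x].*-identityˡ ℚ[x].1#))

ι-- : ∀ p q → ι (p ℚ[x].- q) ≈ ι p - ι q
-- `- ι q` is `ι (ℚ[x].- q)` by definition.
ι-- p q = ι-+ p (ℚ[x].- q)

ι2X≈2x : ι Chebyshev.2X ≈ 2# * x
ι2X≈2x = ℚ⟨x⟩.trans (ι-* (Polynomial.const (1ℚ ℚ.+ 1ℚ)) Polynomial.X)
  -- The constant polynomial 2 is `ℚ[x].1# ℚ[x].+ ℚ[x].1#` by computation.
  (ℚ⟨x⟩.*-congʳ {x} (ι-+ ℚ[x].1# ℚ[x].1#))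

-- The instance of `w`: the extra term U₋₁ = 0 makes the recurrence hold from U 1 on.
ιU : ℕ → Carrier
ιU zero    = 0#
ιU (suc n) = ι (U n)

ιU-rec : ∀ n → ιU (suc (suc n)) ≈ 2# * x * ιU (suc n) - ιU n
ιU-rec zero    = begin
  ι Chebyshev.2X   ≈⟨ ι2X≈2x ⟩
  2# * x           ≈⟨ ℚ⟨x⟩.*-identityʳ (2# * x) ⟨
  2# * x * 1#      ≈⟨ x-0≈x (2# * x * 1#) ⟨
  2# * x * 1# - 0# ∎
  where
  open SetoidReasoning ℚ⟨x⟩.setoid
  open HeytingProperties ℚ⟨x⟩.heytingCommutativeRing using (x-0≈x)
ιU-rec (suc n) = begin
  ι (Chebyshev.2X ℚ[x].* U (suc n) ℚ[x].- U n)    ≈⟨ ι-- (Chebyshev.2X ℚ[x].* U (suc n)) (U n) ⟩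
  ι (Chebyshev.2X ℚ[x].* U (suc n)) - ι (U n)     ≈⟨ ℚ⟨x⟩.+-congʳ { - ι (U n)} (ι-* Chebyshev.2X (U (suc n))) ⟩
  ι Chebyshev.2X * ι (U (suc n)) - ι (U n)        ≈⟨ ℚ⟨x⟩.+-congʳ { - ι (U n)} (ℚ⟨x⟩.*-congʳ {ι (U (suc n))} ι2X≈2x) ⟩
  2# * x * ι (U (suc n)) - ι (U n)                ∎
  where open SetoidReasoning ℚ⟨x⟩.setoid

ιU#0 : ∀ n → ι (U n) # 0#
ιU#0 n e = U≉0 n (ι-injective e)

ΔιU#0 : ∀ n → ιU (suc n) - ιU n # 0#
-- The first difference is taken against U₋₁ = 0, so it equals U 0.
ΔιU#0 zero    e = U≉0 0 (ι-injective (ℚ⟨x⟩.x∙y⁻¹≈ε⇒x≈y (ιU 1) 0# e))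
ΔιU#0 (suc n) e = U-suc≉U n (ι-injective (ℚ⟨x⟩.x∙y⁻¹≈ε⇒x≈y (ιU (suc (suc n))) (ιU (suc n)) e))

theorem1p4 : (n : ℕ) →
  let as = (2# * x - 1#) ∷ 1# ∷ concat (replicate n (2# * (x - 1#) ∷ 1# ∷ [])) in
  Σ[ U#0 ∈ ι (U (suc n)) # 0# ]
  Σ[ d ∈ WellDefined 0# as ]
    ι (U n) / ι (U (suc n)) ⟨ U#0 ⟩ ≈ [ 0# ⨾ as ]⟨ d ⟩
-- Owing to the shift in `ιU`, index `n` of `ratio` concerns U n / U (n + 1).
theorem1p4 n =
  ιU#0 (suc n) , ratio ℚ⟨x⟩ x ιU ℚ⟨x⟩.refl ιU-rec ιU#0 ΔιU#0 n
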